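{- Let $(\ell,\mathcal{S},d,y)$ be a WPCS instance with $\mathcal{S}$ non-interleaving. Then there exists an integral selection $z$ for $\mathcal{S}$ with $D_{y,z}\le d_{\max}$, where $d_{\max}=\max_{S\in\mathcal{S}}d_S$. Moreover, such $z$ can be computed in time $O(\ell)$.
   Context: $[\ell]=\{1,\dots,\ell\}$; for $q\in\mathbb{R}^\ell$ and $U\subseteq[\ell]$, $q(U)=\sum_{i\in U}q_i$. Two disjoint sets $S_1,S_2\subseteq\mathbb{Z}_{>0}$ are interleaving if there exist $a_1,b_1\in S_1$, $a_2,b_2\in S_2$ with $a_1<a_2<b_1<b_2$ or $a_2<a_1<b_2<b_1$; a partition of $[\ell]$ is non-interleaving if no two distinct members are interleaving. For a partition $\mathcal{S}$ of $[\ell]$, a fractional selection is a vector $y\in[0,1]^\ell$ (rational) with $y(S)=1$ for all $S\in\mathcal{S}$, and an integral selection is $z\in\{0,1\}^\ell$ with $z(S)=1$ for all $S\in\mathcal{S}$. A WPCS instance is a tuple $(\ell,\mathcal{S},d,y)$ with $\ell\in\mathbb{Z}_{\ge0}$, $\mathcal{S}$ a partition of $[\ell]$, $d\in\mathbb{Q}_{\ge0}^{\mathcal{S}}$, and $y$ a fractional selection for $\mathcal{S}$. For $q\in[0,1]^\ell$ the load vector $q^d$ is $q^d_i=d_S\,q_i$ where $S\in\mathcal{S}$ contains $i$. For $I\subseteq[\ell]$ and selections $y,z$, $D_{y,z}(I)=|y^d(I)-z^d(I)|$. A circular interval is $\emptyset$, or for $i,j\in[\ell]$ the set $\{i,\dots,j\}$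 if $i\le j$, or $\{i,\dots,\ell,1,\dots,j\}$ if $j<i$. The interval-discrepancy is $D_{y,z}=\max\{D_{y,z}(I): I\subseteq[\ell]\text{ circular interval}\}$. -}

module Defs where

open import Data.Bool using (Bool; true; false; not; if_then_else_; _∧_; _∨_)
open import Data.Fin using (Fin; toℕ; _≤?_) renaming (_<_ to _<ᶠ_)
open import Data.Fin.Subset using (Subset; _∈_; _∩_; ⊥; Nonempty; Empty)
open import Data.List using (List; map; allFin; cartesianProductWith)
  renaming (tabulate to tabulateᴸ)
open import Data.Nat as ℕ using (ℕ; suc)
open import Data.Product using (∃; ∃-syntax; _×_; proj₁)
open import Data.Rational using (ℚ; 0ℚ; 1ℚ; _≤_; _≤ᵇ_; _+_; _-_; _*_; ∣_∣)
open import Data.Rational.Properties using (≤-decTotalOrder; +-0-commutativeMonoid)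
open import Data.Sum using (_⊎_)
open import Data.Vec using (lookup; tabulate)
open import Data.Vec.Functional using (Vector)
open import Relation.Binary.Bundles using (DecTotalOrder)
open import Relation.Binary.PropositionalEquality using (_≡_; _≢_)
open import Relation.Nullary using (¬_; does)

open import Algebra.Properties.CommutativeMonoid.Sum +-0-commutativeMonoid using (sum)
open import Data.List.Extrema (DecTotalOrder.totalOrder ≤-decTotalOrder) using (max)

-- The ground set [ℓ] = {1,…,ℓ} is Fin ℓ throughout (shifted to {0,…,ℓ-1}).

------------------------------------------------------------------------
-- Partitions

-- The members are listed without repetition: being nonempty and pairwise
-- disjoint, members with distinct indices are distinct sets.
record Partition (ℓ : ℕ) : Set where
  field
    size     : ℕ
    member   : Fin size → Subset ℓ
    nonempty : ∀ s → Nonempty (member s)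
    disjoint : ∀ s t → s ≢ t → Empty (member s ∩ member t)
    covering : ∀ i → ∃[ s ] i ∈ member s

  memberOf : Fin ℓ → Fin size
  memberOf i = proj₁ (covering i)

open Partition public

Interleaving : ∀ {ℓ} → Subset ℓ → Subset ℓ → Set
Interleaving S₁ S₂ =
  ∃[ a₁ ] ∃[ b₁ ] ∃[ a₂ ] ∃[ b₂ ]
    a₁ ∈ S₁ × b₁ ∈ S₁ × a₂ ∈ S₂ × b₂ ∈ S₂ ×
    ((a₁ <ᶠ a₂ × a₂ <ᶠ b₁ × b₁ <ᶠ b₂) ⊎ (a₂ <ᶠ a₁ × a₁ <ᶠ b₂ × b₂ <ᶠ b₁))

NonInterleaving : ∀ {ℓ} → Partition ℓ → Set
NonInterleaving 𝒮 = ∀ s t → s ≢ t → ¬ Interleaving (member 𝒮 s) (member 𝒮 t)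

------------------------------------------------------------------------
-- Selections and instances

infix 8 _⟨_⟩

_⟨_⟩ : ∀ {ℓ} → Vector ℚ ℓ → Subset ℓ → ℚ
q ⟨ U ⟩ = sum (λ i → if lookup U i then q i else 0ℚ)

record FractionalSelection {ℓ} (𝒮 : Partition ℓ) (y : Vector ℚ ℓ) : Set where
  field
    lower : ∀ i → 0ℚ ≤ y i
    upper : ∀ i → y i ≤ 1ℚ
    unit  : ∀ s → y ⟨ member 𝒮 s ⟩ ≡ 1ℚ

record IntegralSelection {ℓ} (𝒮 : Partition ℓ) (z : Vector ℚ ℓ) : Set where
  field
    binary : ∀ i → z i ≡ 0ℚ ⊎ z i ≡ 1ℚ
    unit   : ∀ s → z ⟨ member 𝒮 s ⟩ ≡ 1ℚ

record WPCS : Set where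
  field
    ℓ          : ℕ
    𝒮          : Partition ℓ
    d          : Vector ℚ (size 𝒮)
    d-nonneg   : ∀ s → 0ℚ ≤ d s
    y          : Vector ℚ ℓ
    fractional : FractionalSelection 𝒮 y

  load : Vector ℚ ℓ → Vector ℚ ℓ
  load q i = d (memberOf 𝒮 i) * q i

  -- For ℓ = 0 there are no members, and the maximum is 0; otherwise the
  -- base value 0 is irrelevant because d ≥ 0.
  dmax : ℚ
  dmax = max 0ℚ (tabulateᴸ d)

open WPCS public using (ℓ; 𝒮; d; y; load; dmax)

------------------------------------------------------------------------
-- Interval-discrepancy

-- {i,…,j} if i ≤ j, and {i,…,ℓ,1,…,j} if j < i.
arc : ∀ {n} → Fin n → Fin n → Subset n
arc i j = tabulate λ k →
  if does (i ≤? j) then does (i ≤? k) ∧ does (k ≤? j)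
                   else does (i ≤? k) ∨ does (k ≤? j)

-- D_{y,z}(I)
discrepancyOn : (w : WPCS) → Vector ℚ (ℓ w) → Subset (ℓ w) → ℚ
discrepancyOn w z I = ∣ load w (y w) ⟨ I ⟩ - load w z ⟨ I ⟩ ∣

-- D_{y,z}: the maximum over the circular intervals, i.e. ∅ and all arcs.
discrepancy : (w : WPCS) → Vector ℚ (ℓ w) → ℚ
discrepancy w z =
  max (discrepancyOn w z ⊥)
      (map (discrepancyOn w z)
           (cartesianProductWith arc (allFin (ℓ w)) (allFin (ℓ w))))

------------------------------------------------------------------------
-- Machine model for running times
--
-- A random-access machine with structured control flow.  The memory
-- consists of arrays (named by numbers; a scalar is a cell of an array) of
-- natural numbers, used for indices, and of rationals.  Every arithmetic
-- operation, comparison, Boolean connective, constant, memory access and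
-- control-flow step costs one unit.  This is the usual arithmetic model, with
-- rationals restricted to +, -, * and ≤ (no rounding, no conversion to
-- indices) and naturals to +, ∸ and <.

record State : Set where
  constructor ⟪_,_⟫
  field
    nat : ℕ → ℕ → ℕ
    rat : ℕ → ℕ → ℚ

open State public

update : {A : Set} → (ℕ → ℕ → A) → ℕ → ℕ → A → ℕ → ℕ → A
update m a k v a′ k′ = if (a ℕ.≡ᵇ a′) ∧ (k ℕ.≡ᵇ k′) then v else m a′ k′

data NatExp : Set where
  lit     : ℕ → NatExp
  read    : ℕ → NatExp → NatExp
  add sub : NatExp → NatExp → NatExp

data RatExp : Set where
  lit         : ℚ → RatExp
  read        : ℕ → NatExp → RatExp
  add sub mul : RatExp → RatExp → RatExp

data BoolExp : Set where
  ltN : NatExp → NatExp → BoolExp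
  leQ : RatExp → RatExp → BoolExp
  neg : BoolExp → BoolExp
  and : BoolExp → BoolExp → BoolExp

data Program : Set where
  skip   : Program
  setNat : ℕ → NatExp → NatExp → Program
  setRat : ℕ → NatExp → RatExp → Program
  _then_ : Program → Program → Program
  branch : BoolExp → Program → Program → Program
  while  : BoolExp → Program → Program

infixr 5 _then_

evalN : State → NatExp → ℕ
evalN σ (lit n)    = n
evalN σ (read a e) = nat σ a (evalN σ e)
evalN σ (add e f)  = evalN σ e ℕ.+ evalN σ f
evalN σ (sub e f)  = evalN σ e ℕ.∸ evalN σ f

evalQ : State → RatExp → ℚ
evalQ σ (lit q)    = q
evalQ σ (read a e) = rat σ a (evalN σ e)
evalQ σ (add e f)  = evalQ σ e + evalQ σ f
evalQ σ (sub e f)  = evalQ σ e - evalQ σ f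
evalQ σ (mul e f)  = evalQ σ e * evalQ σ f

evalB : State → BoolExp → Bool
evalB σ (ltN e f) = evalN σ e ℕ.<ᵇ evalN σ f
evalB σ (leQ e f) = evalQ σ e ≤ᵇ evalQ σ f
evalB σ (neg b)   = not (evalB σ b)
evalB σ (and b c) = evalB σ b ∧ evalB σ c

costN : NatExp → ℕ
costN (lit n)    = 1
costN (read a e) = suc (costN e)
costN (add e f)  = suc (costN e ℕ.+ costN f)
costN (sub e f)  = suc (costN e ℕ.+ costN f)

costQ : RatExp → ℕ
costQ (lit q)    = 1
costQ (read a e) = suc (costN e)
costQ (add e f)  = suc (costQ e ℕ.+ costQ f)
costQ (sub e f)  = suc (costQ e ℕ.+ costQ f)
costQ (mul e f)  = suc (costQ e ℕ.+ costQ f)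

costB : BoolExp → ℕ
costB (ltN e f) = suc (costN e ℕ.+ costN f)
costB (leQ e f) = suc (costQ e ℕ.+ costQ f)
costB (neg b)   = suc (costB b)
costB (and b c) = suc (costB b ℕ.+ costB c)

-- Exec p σ t σ′: started in σ, the program p halts in state σ′ after
-- exactly t units of time.
data Exec : Program → State → ℕ → State → Set where

  skip : ∀ {σ} → Exec skip σ 1 σ

  setNat : ∀ {σ a k e} →
    Exec (setNat a k e) σ (suc (costN k ℕ.+ costN e))
         ⟪ update (nat σ) a (evalN σ k) (evalN σ e) , rat σ ⟫

  setRat : ∀ {σ a k e} →
    Exec (setRat a k e) σ (suc (costN k ℕ.+ costQ e))
         ⟪ nat σ , update (rat σ) a (evalN σ k) (evalQ σ e) ⟫

  seq : ∀ {p q σ σ′ σ″ t u} →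
    Exec p σ t σ′ → Exec q σ′ u σ″ → Exec (p then q) σ (t ℕ.+ u) σ″

  if-true : ∀ {b p q σ σ′ t} → evalB σ b ≡ true →
    Exec p σ t σ′ → Exec (branch b p q) σ (suc (costB b ℕ.+ t)) σ′

  if-false : ∀ {b p q σ σ′ t} → evalB σ b ≡ false →
    Exec q σ t σ′ → Exec (branch b p q) σ (suc (costB b ℕ.+ t)) σ′

  while-true : ∀ {b p σ σ′ σ″ t u} → evalB σ b ≡ true →
    Exec p σ t σ′ → Exec (while b p) σ′ u σ″ →
    Exec (while b p) σ (suc (costB b ℕ.+ t ℕ.+ u)) σ″

  while-false : ∀ {b p σ} → evalB σ b ≡ false →
    Exec (while b p) σ (suc (costB b)) σ

-- Input format.  Array 0 of naturals holds ℓ and |𝒮| in cells 0 and 1;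
-- array 1 of naturals holds, for each i, the index of the member of 𝒮
-- containing i; arrays 0 and 1 of rationals hold d and y.  All other cells
-- have arbitrary contents.
record Encodes (σ : State) (w : WPCS) : Set where
  field
    ground  : nat σ 0 0 ≡ ℓ w
    members : nat σ 0 1 ≡ size (𝒮 w)
    part    : ∀ i s → i ∈ member (𝒮 w) s → nat σ 1 (toℕ i) ≡ toℕ s
    demand  : ∀ s → rat σ 0 (toℕ s) ≡ d w s
    select  : ∀ i → rat σ 1 (toℕ i) ≡ y w i

-- The output z is read off array 2 of rationals.
output : State → (n : ℕ) → Vector ℚ n
output σ n i = rat σ 2 (toℕ i)

-- A single program p that solves, on every instance satisfying Pre, the
-- task of computing a vector z with Post, in time O(ℓ).  The bound is
-- c (1 + ℓ) so that it also makes sense for ℓ = 0.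
ComputableInLinearTime : (Pre : WPCS → Set) (Post : ∀ w → Vector ℚ (ℓ w) → Set) → Set
ComputableInLinearTime Pre Post =
  ∃[ p ] ∃[ c ] ∀ w → Pre w → ∀ σ → Encodes σ w →
    ∃[ t ] ∃[ σ′ ]
      Exec p σ t σ′ × t ℕ.≤ c ℕ.* suc (ℓ w) × Post w (output σ′ (ℓ w))

{-# OPTIONS --safe #-}
-- Non-interleaving makes the excess, i.e. the prefix sums of yᵈ − zᵈ, behave
-- like a stack: between the first position f of a member S and a position i of
-- S, every other member lies entirely inside or outside, and a member lying
-- inside contributes 0.  So the excess at i differs from the one before f only
-- by the contribution of S itself.  Greedy rounding from left to right selects
-- i in a still unselected S when the excess would otherwise exceed
-- D = d_max, or when i is the last position of S, and keeps the excess in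
-- [0, D]; an arc has as discrepancy the distance between two such values.
module Submission where

open import Defs
open import Data.Product using (∃-syntax; _×_; _,_; proj₁; proj₂)
open import Data.Rational
  using (ℚ; 0ℚ; 1ℚ; _≤_; _≤ᵇ_; _+_; _-_; _*_; -_; ∣_∣; nonNegative)

open import Algebra.Bundles using (CommutativeRing)
open import Data.Bool using (Bool; true; false; if_then_else_; _∧_; _∨_; not; T)
open import Data.Empty using (⊥-elim)
open import Data.Fin using (Fin; zero; suc; toℕ; fromℕ<)
open import Data.Fin.Properties using (_≟_; toℕ-injective; toℕ<n; toℕ-fromℕ<)
open import Data.Fin.Subset using (_∈_; ⊥)
open import Data.Fin.Subset.Properties using (x∈p∩q⁺)
open import Data.List using (allFin) renaming (tabulate to tabulateᴸ)
open import Data.List.Membership.Propositional.Properties using (∈-tabulate⁺)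
import Data.List.Relation.Unary.All as All
import Data.List.Relation.Unary.All.Properties as All
open import Data.Nat as ℕ using (ℕ; zero; suc; z≤n; s≤s; _<?_; _≤?_)
import Data.Nat.Properties as ℕ
open import Data.Nat.Solver using () renaming (module +-*-Solver to ℕ-Solver)
open import Data.Rational.Properties
  using ( ≤-refl; ≤-trans; ≤-reflexive; <⇒≤; ≰⇒>; ≤ᵇ⇒≤; ≤⇒≤ᵇ
        ; +-identityˡ; +-identityʳ; +-comm; +-inverseʳ; *-zeroʳ
        ; +-mono-≤; +-monoˡ-≤; +-monoʳ-≤; neg-antimono-≤; *-monoˡ-≤-nonNeg; ∣p∣≡p∨∣p∣≡-p
        ; +-0-group; +-0-commutativeMonoid; +-*-commutativeRing
        ; ≤-decTotalOrder; module ≤-Reasoning )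
open import Data.Rational.Solver using () renaming (module +-*-Solver to ℚ-Solver)
open import Data.Sum using (_⊎_; inj₁; inj₂; [_,_]′)
open import Data.Unit using (tt)
open import Data.Vec using (lookup)
open import Data.Vec.Functional using (Vector; updateAt)
open import Data.Vec.Functional.Properties using (updateAt-updates; updateAt-minimal)
open import Data.Vec.Properties
  using (lookup∘tabulate; lookup-replicate; []=⇒lookup; lookup⇒[]=)
open import Function using (_∘_; const; mk⇔; _⇔_)
open import Relation.Binary.Bundles using (DecTotalOrder)
open import Relation.Binary.Definitions using (tri<; tri≈; tri>)
open import Relation.Binary.PropositionalEquality
open import Relation.Nullary using (¬_; Dec; yes; no; does)
open import Relation.Nullary.Decidable using (dec-true; dec-false; does-⇔; _×-dec_; _⊎-dec_)

open import Algebra.Properties.CommutativeMonoid.Sum +-0-commutativeMonoid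
  using (sum; sum-cong-≗; sum-replicate-zero; ∑-distrib-+; ∑-comm)
open import Algebra.Properties.Group +-0-group using () renaming (∙-cancelˡ to +-cancelˡ)
open import Algebra.Properties.Semiring.Sum (CommutativeRing.semiring +-*-commutativeRing)
  using (*-distribˡ-sum)
open import Data.List.Extrema (DecTotalOrder.totalOrder ≤-decTotalOrder)
  using (max≤v⁺; xs≤max; ⊥≤max)

-- The stack property is used through the part of S that lies after i: the excess after i plus this
-- remainder equals the excess before f. Once S is selected, the remainder contains unselected
-- positions only and is nonnegative, so the excess after i is at most the earlier value. At the
-- last position the remainder is empty, so a forced selection, which might otherwise drive the
-- excess below 0, returns exactly to the earlier value. The remainder depends on positions that are
-- not yet rounded when i is treated. The loop invariant therefore records only why each decision
-- was taken, and the bounds are derived for the finished rounding. Linear time needs no explicit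
-- stack: one stored position per member tells both whether the member is already selected and
-- whether its last position is reached. Existence is read off a run of the program.

private variable
  A B : Set

-- Indicator-weighted sums

when : Dec A → ℚ → ℚ
when a? x = if does a? then x else 0ℚ

when-yes : (a? : Dec A) → A → ∀ {x} → when a? x ≡ x
when-yes a? a rewrite dec-true a? a = refl

when-no : (a? : Dec A) → ¬ A → ∀ {x} → when a? x ≡ 0ℚ
when-no a? ¬a rewrite dec-false a? ¬a = refl

when-⇔ : A ⇔ B → (a? : Dec A) (b? : Dec B) → ∀ {x} → when a? x ≡ when b? x
when-⇔ A⇔B a? b? rewrite does-⇔ A⇔B a? b? = refl

when-cong : (a? : Dec A) → ∀ {x y} → (A → x ≡ y) → when a? x ≡ when a? y
when-cong (yes a) x≡y = x≡y a
when-cong (no _)  _   = refl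

when-nonNeg : (a? : Dec A) → ∀ {x} → (A → 0ℚ ≤ x) → 0ℚ ≤ when a? x
when-nonNeg (yes a) 0≤x = 0≤x a
when-nonNeg (no _)  _   = ≤-refl

sum-zero : ∀ {n} {f : Vector ℚ n} → (∀ j → f j ≡ 0ℚ) → sum f ≡ 0ℚ
sum-zero {n} f≗0 = trans (sum-cong-≗ f≗0) (sum-replicate-zero n)

sum-nonNeg : ∀ {n} {f : Vector ℚ n} → (∀ j → 0ℚ ≤ f j) → 0ℚ ≤ sum f
sum-nonNeg {zero}  0≤f = ≤-refl
sum-nonNeg {suc n} 0≤f = +-mono-≤ (0≤f zero) (sum-nonNeg (0≤f ∘ suc))

-- Two ways of splitting a set of indices are compared pointwise, with two indicator sums on each
-- side instead of differences of sums.
sum-+-cong : ∀ {n} {f g h e : Vector ℚ n} → (∀ j → f j + g j ≡ h j + e j) →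
             sum f + sum g ≡ sum h + sum e
sum-+-cong {f = f} {g} {h} {e} eq =
  trans (sym (∑-distrib-+ f g)) (trans (sum-cong-≗ eq) (∑-distrib-+ h e))

sum-when-≡ : ∀ {n} (i : Fin n) (f : Vector ℚ n) → sum (λ j → when (j ≟ i) (f j)) ≡ f i
sum-when-≡ {suc n} zero f =
  trans (cong (f zero +_) (sum-replicate-zero n)) (+-identityʳ _)
sum-when-≡ {suc n} (suc i) f = trans (+-identityˡ _) (sum-when-≡ i (f ∘ suc))

least : ∀ {n} (P : Fin n → Set) → (∀ i → Dec (P i)) → ∀ i → P i →
        ∃[ l ] P l × (∀ j → P j → toℕ l ℕ.≤ toℕ j)
least {suc n} P P? i Pi with P? zero
... | yes P0 = zero , P0 , λ _ _ → z≤n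
least P P? zero Pi    | no ¬P0 = ⊥-elim (¬P0 Pi)
least P P? (suc i) Pi | no ¬P0 with least (P ∘ suc) (P? ∘ suc) i Pi
... | l , Pl , min = suc l , Pl , λ where
        zero    P0 → ⊥-elim (¬P0 P0)
        (suc j) Pj → s≤s (min j Pj)

-- Greedy rounding

-- `e` is the excess that results if `i` is left unselected. Comparing `i` with `pick` reveals the
-- status of the member: a smaller `pick` means that it is already selected, an equal one that `i`
-- is its last chance.
Selects Skips : (pick i : ℕ) (e D : ℚ) → Set
Selects pick i e D = i ℕ.≤ pick × (pick ℕ.≤ i ⊎ ¬ (e ≤ D))
Skips   pick i e D = pick ℕ.< i ⊎ (i ℕ.< pick × e ≤ D)

-- `D` is any common bound of the demands, so that it can be instantiated with the content of the
-- memory cell in which the program accumulates the largest demand.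
module Greedy {ℓ k : ℕ} (owner : Fin ℓ → Fin k) (d : Vector ℚ k) (y : Vector ℚ ℓ) (D : ℚ)
  (d≥0 : ∀ s → 0ℚ ≤ d s) (d≤D : ∀ s → d s ≤ D) (0≤D : 0ℚ ≤ D) (y≥0 : ∀ i → 0ℚ ≤ y i)
  (y-unit : ∀ s → sum (λ j → when (s ≟ owner j) (y j)) ≡ 1ℚ)
  (noncrossing : ∀ a b c e → toℕ a ℕ.< toℕ b → toℕ b ℕ.< toℕ c → toℕ c ℕ.< toℕ e →
                 owner a ≡ owner c → owner b ≡ owner e → owner a ≡ owner b) where

  open ℚ-Solver using (solve; _:+_; _:*_; _:-_; _:=_; :-_; con)

  δ : Vector ℚ ℓ → Vector ℚ ℓ
  δ z j = d (owner j) * y j - d (owner j) * z j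

  excess : Vector ℚ ℓ → ℕ → ℚ
  excess z n = sum (λ j → when (toℕ j <? n) (δ z j))

  excess-zero : ∀ z → excess z 0 ≡ 0ℚ
  excess-zero z = sum-zero {f = λ j → when (toℕ j <? 0) (δ z j)}
                           λ j → when-no (toℕ j <? 0) (λ ()) {δ z j}

  excess-cong : ∀ {z z′} n → (∀ j → toℕ j ℕ.< n → z j ≡ z′ j) → excess z n ≡ excess z′ n
  excess-cong {z} {z′} n eq = sum-cong-≗ λ j → when-cong (toℕ j <? n)
    λ j<n → cong (λ q → d (owner j) * y j - d (owner j) * q) (eq j j<n)

  excess-suc : ∀ z i → excess z (suc (toℕ i)) ≡ excess z (toℕ i) + δ z i
  excess-suc z i = begin
    excess z (suc (toℕ i))                                    ≡⟨ sum-cong-≗ split ⟩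
    sum (λ j → when (toℕ j <? toℕ i) (δ z j) + when (j ≟ i) (δ z j))
      ≡⟨ ∑-distrib-+ (λ j → when (toℕ j <? toℕ i) (δ z j)) (λ j → when (j ≟ i) (δ z j)) ⟩
    excess z (toℕ i) + sum (λ j → when (j ≟ i) (δ z j))       ≡⟨ cong (excess z (toℕ i) +_) (sum-when-≡ i (δ z)) ⟩
    excess z (toℕ i) + δ z i                                  ∎
    where
    open ≡-Reasoning
    split : ∀ j → when (toℕ j <? suc (toℕ i)) (δ z j) ≡
                  when (toℕ j <? toℕ i) (δ z j) + when (j ≟ i) (δ z j)
    split j with ℕ.<-cmp (toℕ j) (toℕ i)
    ... | tri< j<i j≢i _
        rewrite when-yes (toℕ j <? suc (toℕ i)) (ℕ.m<n⇒m<1+n j<i) {δ z j}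
              | when-yes (toℕ j <? toℕ i) j<i {δ z j}
              | when-no (j ≟ i) (j≢i ∘ cong toℕ) {δ z j} = sym (+-identityʳ _)
    ... | tri≈ j≮i j≡i _
        rewrite when-yes (toℕ j <? suc (toℕ i)) (ℕ.≤-reflexive (cong suc j≡i)) {δ z j}
              | when-no (toℕ j <? toℕ i) j≮i {δ z j}
              | when-yes (j ≟ i) (toℕ-injective j≡i) {δ z j} = sym (+-identityˡ _)
    ... | tri> j≮i j≢i i<j
        rewrite when-no (toℕ j <? suc (toℕ i)) (ℕ.<⇒≱ i<j ∘ ℕ.s≤s⁻¹) {δ z j}
              | when-no (toℕ j <? toℕ i) j≮i {δ z j}
              | when-no (j ≟ i) (j≢i ∘ cong toℕ) {δ z j} = refl

  -- The state after rounding the first n positions.  Initially pick s is the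
  -- last position of s, so that an early selection can only decrease it.
  record Greedy (n : ℕ) (pick : Fin k → Fin ℓ) (z : Vector ℚ ℓ) : Set where
    field
      pick∈  : ∀ s → owner (pick s) ≡ s
      isLast : ∀ s → n ℕ.≤ toℕ (pick s) → ∀ j → owner j ≡ s → toℕ j ℕ.≤ toℕ (pick s)
      chosen : ∀ j → toℕ j ℕ.< n → z j ≡ when (pick (owner j) ≟ j) 1ℚ
      before : ∀ j → toℕ j ℕ.< n → toℕ j ℕ.< toℕ (pick (owner j)) →
               excess z (suc (toℕ j)) ≤ D
      at     : ∀ j → toℕ j ℕ.< n → pick (owner j) ≡ j →
               0ℚ ≤ excess z (suc (toℕ j)) ⊎ (∀ i → owner i ≡ owner j → toℕ i ℕ.≤ toℕ j)

  open Greedy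

  greedy-start : ∀ pick z → (∀ s → owner (pick s) ≡ s) →
                 (∀ j → toℕ j ℕ.≤ toℕ (pick (owner j))) → Greedy 0 pick z
  greedy-start pick z ∈s last = record
    { pick∈  = ∈s
    ; isLast = λ { s _ j refl → last j }
    ; chosen = λ _ ()
    ; before = λ _ ()
    ; at     = λ _ ()
    }

  -- Preservation of the greedy invariant by one more position

  <suc-elim : ∀ (i : Fin ℓ) (P : Fin ℓ → Set) → (∀ j → toℕ j ℕ.< toℕ i → P j) → P i →
              ∀ j → toℕ j ℕ.< suc (toℕ i) → P j
  <suc-elim i P below here j j<1+i with ℕ.m≤n⇒m<n∨m≡n (ℕ.s≤s⁻¹ j<1+i)
  ... | inj₁ j<i = below j j<i
  ... | inj₂ j≡i = subst P (sym (toℕ-injective j≡i)) here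

  -- Rounding `i` cannot disturb what is on record about earlier positions: `excess` up to `n` reads
  -- `z` only below `n`.
  excess-below : ∀ {z z′} i → (∀ j → j ≢ i → z′ j ≡ z j) →
                 ∀ n → n ℕ.≤ toℕ i → excess z′ n ≡ excess z n
  excess-below i agree n n≤i = excess-cong n λ j j<n →
    agree j λ j≡i → ℕ.<-irrefl (cong toℕ j≡i) (ℕ.<-≤-trans j<n n≤i)

  -- The vectors model the output array before and after one write. Its cells from `i` on may hold
  -- anything beforehand, hence agreement is asked only away from `i`.
  module _ {pick : Fin k → Fin ℓ} {z z′ : Vector ℚ ℓ} (i : Fin ℓ) (agree : ∀ j → j ≢ i → z′ j ≡ z j)
           (greedy : Greedy (toℕ i) pick z) where

    private
      s = owner i

      <⇒≢ : ∀ {j : Fin ℓ} → toℕ j ℕ.< toℕ i → j ≢ i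
      <⇒≢ j<i j≡i = ℕ.<-irrefl (cong toℕ j≡i) j<i

    excess-next : ∀ {q} → z′ i ≡ q →
                  excess z′ (suc (toℕ i)) ≡ excess z (toℕ i) + (d s * y i - d s * q)
    excess-next refl = trans (excess-suc z′ i)
      (cong (_+ δ z′ i) (excess-below i agree (toℕ i) ℕ.≤-refl))

    excess-skip : z′ i ≡ 0ℚ → excess z′ (suc (toℕ i)) ≡ excess z (toℕ i) + d s * y i
    excess-skip z′i≡0 = trans (excess-next z′i≡0)
      (solve 3 (λ e a b → e :+ (a :* b :- a :* con 0ℚ) := e :+ a :* b) refl
        (excess z (toℕ i)) (d s) (y i))

    excess-select : z′ i ≡ 1ℚ → excess z′ (suc (toℕ i)) ≡ excess z (toℕ i) + d s * y i - d s
    excess-select z′i≡1 = trans (excess-next z′i≡1)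
      (solve 3 (λ e a b → e :+ (a :* b :- a :* con 1ℚ) := e :+ a :* b :- a) refl
        (excess z (toℕ i)) (d s) (y i))

    greedy-skip : z′ i ≡ 0ℚ →
      Skips (toℕ (pick s)) (toℕ i) (excess z (toℕ i) + d s * y i) D →
      Greedy (suc (toℕ i)) pick z′
    greedy-skip z′i≡0 skips = record
      { pick∈  = pick∈ greedy
      ; isLast = λ t i<p → isLast greedy t (ℕ.<⇒≤ i<p)
      ; chosen = <suc-elim i (λ j → z′ j ≡ when (pick (owner j) ≟ j) 1ℚ)
          (λ j j<i → trans (agree j (<⇒≢ j<i)) (chosen greedy j j<i))
          (trans z′i≡0 (sym (when-no (pick s ≟ i) p≢i)))
      ; before = <suc-elim i (λ j → toℕ j ℕ.< toℕ (pick (owner j)) → excess z′ (suc (toℕ j)) ≤ D)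
          (λ j j<i j<p → subst (_≤ D) (sym (excess-below i agree _ j<i)) (before greedy j j<i j<p))
          λ i<p → subst (_≤ D) (sym (excess-skip z′i≡0))
            ([ (λ p<i → ⊥-elim (ℕ.<-asym p<i i<p)) , proj₂ ]′ skips)
      ; at     = <suc-elim i (λ j → pick (owner j) ≡ j → 0ℚ ≤ excess z′ (suc (toℕ j)) ⊎ _)
          (λ j j<i p≡j → subst (λ e → 0ℚ ≤ e ⊎ _) (sym (excess-below i agree _ j<i))
                           (at greedy j j<i p≡j))
          (⊥-elim ∘ p≢i)
      }
      where
      p≢i : pick s ≢ i
      p≢i p≡i = [ ℕ.<-irrefl (cong toℕ p≡i) , ℕ.<-irrefl (cong toℕ (sym p≡i)) ∘ proj₁ ]′ skips

    -- Lowering `pick s` to `i` is invisible below `i`: since `i ≤ pick s`, every earlier position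
    -- of the member lies strictly before both the old and the new pick.
    greedy-select : z′ i ≡ 1ℚ →
      Selects (toℕ (pick s)) (toℕ i) (excess z (toℕ i) + d s * y i) D →
      Greedy (suc (toℕ i)) (updateAt pick s (const i)) z′
    greedy-select z′i≡1 (i≤p , select) = record
      { pick∈  = pick′∈
      ; isLast = isLast′
      ; chosen = <suc-elim i (λ j → z′ j ≡ when (pick′ (owner j) ≟ j) 1ℚ)
          chosen′ (trans z′i≡1 (sym (when-yes (pick′ s ≟ i) p′s≡i)))
      ; before = <suc-elim i (λ j → toℕ j ℕ.< toℕ (pick′ (owner j)) → excess z′ (suc (toℕ j)) ≤ D)
          (λ j j<i j<p → subst (_≤ D) (sym (excess-below i agree _ j<i))
                           (before greedy j j<i (before′ j j<i j<p)))
          (λ i<p → ⊥-elim (ℕ.<-irrefl (cong toℕ (sym p′s≡i)) i<p))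
      ; at     = <suc-elim i (λ j → pick′ (owner j) ≡ j → 0ℚ ≤ excess z′ (suc (toℕ j)) ⊎
                                      (∀ l → owner l ≡ owner j → toℕ l ℕ.≤ toℕ j))
          (λ j j<i p≡j → subst (λ e → 0ℚ ≤ e ⊎ _) (sym (excess-below i agree _ j<i))
                           (at greedy j j<i (at′ j j<i p≡j)))
          (λ _ → atᵢ select)
      }
      where
      pick′ = updateAt pick s (const i)

      p′s≡i : pick′ s ≡ i
      p′s≡i = updateAt-updates s pick

      p′≡p : ∀ {t} → t ≢ s → pick′ t ≡ pick t
      p′≡p {t} = updateAt-minimal t s pick

      pick′∈ : ∀ t → owner (pick′ t) ≡ t
      pick′∈ t with t ≟ s
      ... | yes refl = cong owner p′s≡i
      ... | no  t≢s  = trans (cong owner (p′≡p t≢s)) (pick∈ greedy t)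

      isLast′ : ∀ t → suc (toℕ i) ℕ.≤ toℕ (pick′ t) → ∀ j → owner j ≡ t → toℕ j ℕ.≤ toℕ (pick′ t)
      isLast′ t i<p j j∈t with t ≟ s
      ... | yes refl = ⊥-elim (ℕ.<-irrefl (cong toℕ (sym p′s≡i)) i<p)
      ... | no  t≢s  rewrite p′≡p t≢s = isLast greedy t (ℕ.<⇒≤ i<p) j j∈t

      chosen′ : ∀ j → toℕ j ℕ.< toℕ i → z′ j ≡ when (pick′ (owner j) ≟ j) 1ℚ
      chosen′ j j<i = trans (agree j (<⇒≢ j<i)) (trans (chosen greedy j j<i)
                        (when-⇔ same (pick (owner j) ≟ j) (pick′ (owner j) ≟ j)))
        where
        same : pick (owner j) ≡ j ⇔ pick′ (owner j) ≡ j
        same with owner j ≟ s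
        ... | no  t≢s = mk⇔ (trans (p′≡p t≢s)) (trans (sym (p′≡p t≢s)))
        ... | yes t≡s rewrite t≡s = mk⇔
          (λ p≡j → ⊥-elim (ℕ.<⇒≱ j<i (subst (λ l → toℕ i ℕ.≤ toℕ l) p≡j i≤p)))
          (λ p′≡j → ⊥-elim (<⇒≢ j<i (trans (sym p′≡j) p′s≡i)))

      before′ : ∀ j → toℕ j ℕ.< toℕ i → toℕ j ℕ.< toℕ (pick′ (owner j)) →
                toℕ j ℕ.< toℕ (pick (owner j))
      before′ j j<i j<p with owner j ≟ s
      ... | yes t≡s rewrite t≡s = ℕ.<-≤-trans j<i i≤p
      ... | no  t≢s = subst (λ l → toℕ j ℕ.< toℕ l) (p′≡p t≢s) j<p

      at′ : ∀ j → toℕ j ℕ.< toℕ i → pick′ (owner j) ≡ j → pick (owner j) ≡ j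
      at′ j j<i p′≡j with owner j ≟ s
      ... | yes t≡s = ⊥-elim (<⇒≢ j<i (trans (sym p′≡j) (trans (cong pick′ t≡s) p′s≡i)))
      ... | no  t≢s = trans (sym (p′≡p t≢s)) p′≡j

      -- A selection caused by an excess above `D` subtracts only `d s`, which is at most `D`. A
      -- forced one happens at `pick s` itself, which `isLast` still certifies as the last position.
      atᵢ : toℕ (pick s) ℕ.≤ toℕ i ⊎ ¬ (excess z (toℕ i) + d s * y i ≤ D) →
            0ℚ ≤ excess z′ (suc (toℕ i)) ⊎ (∀ l → owner l ≡ s → toℕ l ℕ.≤ toℕ i)
      atᵢ (inj₁ p≤i) = inj₂ λ l l∈s → ℕ.≤-trans (isLast greedy s i≤p l l∈s) p≤i
      atᵢ (inj₂ e≰D) = inj₁ (begin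
        0ℚ                                   ≡⟨ +-inverseʳ (d s) ⟨
        d s - d s                            ≤⟨ +-monoˡ-≤ (- d s) (≤-trans (d≤D s) (<⇒≤ (≰⇒> e≰D))) ⟩
        excess z (toℕ i) + d s * y i - d s   ≡⟨ excess-select z′i≡1 ⟨
        excess z′ (suc (toℕ i))              ∎)
        where open ≤-Reasoning

  -- Bounds on the excess of a finished rounding

  module _ {pick : Fin k → Fin ℓ} {z : Vector ℚ ℓ} (greedy : Greedy ℓ pick z) where

    z≗ : ∀ j → z j ≡ when (pick (owner j) ≟ j) 1ℚ
    z≗ j = chosen greedy j (toℕ<n j)

    z-unit : ∀ s → sum (λ j → when (s ≟ owner j) (z j)) ≡ 1ℚ
    z-unit s = trans (sum-cong-≗ eq) (sum-when-≡ (pick s) (const 1ℚ))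
      where
      eq : ∀ j → when (s ≟ owner j) (z j) ≡ when (j ≟ pick s) 1ℚ
      eq j with s ≟ owner j
      ... | yes refl = trans (z≗ j) (when-⇔ (mk⇔ sym sym) (pick s ≟ j) (j ≟ pick s))
      ... | no  s≢   = sym (when-no (j ≟ pick s)
                         λ { refl → s≢ (sym (pick∈ greedy s)) })

    member-sum : ∀ s → sum (λ j → when (s ≟ owner j) (δ z j)) ≡ 0ℚ
    -- Adding `d s * 1ℚ`, written as the weighted total of `z` on the member, cancels the
    -- subtraction inside `δ` and leaves the weighted total of `y`, which is the same number.
    member-sum s = +-cancelˡ (d s * 1ℚ) _ _ (begin
      d s * 1ℚ + sum (λ j → when (s ≟ owner j) (δ z j))
        ≡⟨ cong (λ q → d s * q + sum (λ j → when (s ≟ owner j) (δ z j))) (z-unit s) ⟨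
      d s * sum z∣s + sum (λ j → when (s ≟ owner j) (δ z j))
        ≡⟨ cong (_+ sum (λ j → when (s ≟ owner j) (δ z j))) (*-distribˡ-sum (d s) z∣s) ⟩
      sum (λ j → d s * z∣s j) + sum (λ j → when (s ≟ owner j) (δ z j))
        ≡⟨ sum-+-cong eq ⟩
      sum (λ j → d s * y∣s j) + sum {ℓ} (const 0ℚ)
        ≡⟨ cong₂ _+_ (sym (*-distribˡ-sum (d s) y∣s)) (sum-replicate-zero ℓ) ⟩
      d s * sum y∣s + 0ℚ
        ≡⟨ cong (λ q → d s * q + 0ℚ) (y-unit s) ⟩
      d s * 1ℚ + 0ℚ ∎)
      where
      open ≡-Reasoning
      y∣s z∣s : Vector ℚ ℓ
      y∣s j = when (s ≟ owner j) (y j)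
      z∣s j = when (s ≟ owner j) (z j)
      eq : ∀ j → d s * z∣s j + when (s ≟ owner j) (δ z j) ≡ d s * y∣s j + 0ℚ
      eq j with s ≟ owner j
      ... | yes refl = solve 3 (λ a b c → a :* b :+ (a :* c :- a :* b) := a :* c :+ con 0ℚ) refl
                         (d s) (z j) (y j)
      ... | no  _    = refl

    -- After regrouping by owner, each member enters wholly or not at all, and a whole member
    -- contributes 0 by `member-sum`. Its pick is the representative at which `P` is tested.
    saturated-sum : {P : Fin ℓ → Set} (P? : ∀ j → Dec (P j)) →
      (∀ i j → owner i ≡ owner j → P i → P j) → sum (λ j → when (P? j) (δ z j)) ≡ 0ℚ
    saturated-sum P? sat = begin
      sum (λ j → x j)                                        ≡⟨ sum-cong-≗ (λ j → sum-when-≡ (owner j) (const (x j))) ⟨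
      sum (λ j → sum (λ s → when (s ≟ owner j) (x j)))       ≡⟨ ∑-comm (λ j s → when (s ≟ owner j) (x j)) ⟩
      sum (λ s → sum (λ j → when (s ≟ owner j) (x j)))       ≡⟨ sum-zero part ⟩
      0ℚ                                                     ∎
      where
      open ≡-Reasoning
      x : Vector ℚ ℓ
      x j = when (P? j) (δ z j)
      part : ∀ s → sum (λ j → when (s ≟ owner j) (x j)) ≡ 0ℚ
      part s with P? (pick s)
      ... | yes Pp = trans (sum-cong-≗ λ j → when-cong (s ≟ owner j) λ s≡ →
                       when-yes (P? j) (sat (pick s) j (trans (pick∈ greedy s) s≡) Pp))
                       (member-sum s)
      ... | no ¬Pp = sum-zero λ j → trans
                       (when-cong (s ≟ owner j) {y = 0ℚ} λ s≡ → when-no (P? j)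
                         (¬Pp ∘ sat j (pick s) (trans (sym s≡) (sym (pick∈ greedy s)))))
                       (when-zero (s ≟ owner j))
        where
        when-zero : (a? : Dec A) → when a? 0ℚ ≡ 0ℚ
        when-zero (yes _) = refl
        when-zero (no _)  = refl

    -- The amount that the member of `i` has still to contribute. Its sign is what the bounds rest
    -- on: nonnegative from the pick onwards, zero at the last position.
    tail : Fin ℓ → ℚ
    tail i = sum (λ j → when ((owner i ≟ owner j) ×-dec (toℕ i <? toℕ j)) (δ z j))

    -- By non-interleaving, the positions between the first position f of a
    -- member and a position i of it, together with that member, form a union
    -- of members.
    excess+tail : ∀ f i → owner f ≡ owner i → (∀ j → owner j ≡ owner i → toℕ f ℕ.≤ toℕ j) →
                  excess z (suc (toℕ i)) + tail i ≡ excess z (toℕ f)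
    excess+tail f i f∈s first = begin
      excess z (suc (toℕ i)) + tail i                        ≡⟨ sum-+-cong split ⟩
      excess z (toℕ f) + sum (λ j → when (hull? j) (δ z j))  ≡⟨ cong (excess z (toℕ f) +_) (saturated-sum hull? saturated) ⟩
      excess z (toℕ f) + 0ℚ                                  ≡⟨ +-identityʳ _ ⟩
      excess z (toℕ f)                                       ∎
      where
      open ≡-Reasoning
      Hull : Fin ℓ → Set
      Hull j = owner i ≡ owner j ⊎ (toℕ f ℕ.≤ toℕ j × toℕ j ℕ.≤ toℕ i)

      hull? : ∀ j → Dec (Hull j)
      hull? j = (owner i ≟ owner j) ⊎-dec ((toℕ f ≤? toℕ j) ×-dec (toℕ j ≤? toℕ i))

      f≤i : toℕ f ℕ.≤ toℕ i
      f≤i = first i refl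

      saturated : ∀ a b → owner a ≡ owner b → Hull a → Hull b
      saturated a b a~b (inj₁ a∈s) = inj₁ (trans a∈s a~b)
      saturated a b a~b (inj₂ (f≤a , a≤i)) with owner i ≟ owner a
      ... | yes a∈s = inj₁ (trans a∈s a~b)
      -- As `f` and `i` belong to the member and `a` does not, `a` lies strictly between them. A
      -- position `b` of the member of `a` before `f` or after `i` would make the two members cross.
      ... | no  a∉s = inj₂ (ℕ.≮⇒≥ b≮f , ℕ.≮⇒≥ i≮b)
        where
        f<a : toℕ f ℕ.< toℕ a
        f<a = ℕ.≤∧≢⇒< f≤a λ f≡a → a∉s (trans (sym f∈s) (cong owner (toℕ-injective f≡a)))
        a<i : toℕ a ℕ.< toℕ i
        a<i = ℕ.≤∧≢⇒< a≤i λ a≡i → a∉s (cong owner (sym (toℕ-injective a≡i)))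
        b≮f : ¬ (toℕ b ℕ.< toℕ f)
        b≮f b<f = a∉s (trans (sym f∈s) (trans
          (sym (noncrossing b f a i b<f f<a a<i (sym a~b) f∈s)) (sym a~b)))
        i≮b : ¬ (toℕ i ℕ.< toℕ b)
        i≮b i<b = a∉s (trans (sym f∈s) (noncrossing f a i b f<a a<i i<b f∈s a~b))

      -- Both sides cover the positions up to `i` and the later ones of its member; the right side
      -- is a disjoint cover because the member has no position before `f`.
      split : ∀ j → when (toℕ j <? suc (toℕ i)) (δ z j)
                  + when ((owner i ≟ owner j) ×-dec (toℕ i <? toℕ j)) (δ z j)
                  ≡ when (toℕ j <? toℕ f) (δ z j) + when (hull? j) (δ z j)
      split j with owner i ≟ owner j | ℕ.<-≤-connex (toℕ j) (toℕ f) | ℕ.≤-<-connex (toℕ j) (toℕ i)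
      ... | yes i~j | inj₁ j<f | _ = ⊥-elim (ℕ.<⇒≱ j<f (first j (sym i~j)))
      ... | yes i~j | inj₂ f≤j | inj₁ j≤i
          rewrite when-yes (toℕ j <? suc (toℕ i)) (s≤s j≤i) {δ z j}
                | when-no (toℕ i <? toℕ j) (ℕ.≤⇒≯ j≤i) {δ z j}
                | when-no (toℕ j <? toℕ f) (ℕ.≤⇒≯ f≤j) {δ z j} = +-comm (δ z j) 0ℚ
      ... | yes i~j | inj₂ f≤j | inj₂ i<j
          rewrite when-no (toℕ j <? suc (toℕ i)) (ℕ.<⇒≱ i<j ∘ ℕ.s≤s⁻¹) {δ z j}
                | when-yes (toℕ i <? toℕ j) i<j {δ z j}
                | when-no (toℕ j <? toℕ f) (ℕ.≤⇒≯ f≤j) {δ z j} = refl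
      ... | no i≁j | inj₁ j<f | inj₂ i<j = ⊥-elim (ℕ.<⇒≱ (ℕ.<-trans i<j j<f) f≤i)
      ... | no i≁j | inj₁ j<f | inj₁ j≤i
          rewrite when-yes (toℕ j <? suc (toℕ i)) (s≤s j≤i) {δ z j}
                | when-yes (toℕ j <? toℕ f) j<f {δ z j}
                | when-no ((toℕ f ≤? toℕ j) ×-dec (toℕ j ≤? toℕ i)) (ℕ.<⇒≱ j<f ∘ proj₁) {δ z j} = refl
      ... | no i≁j | inj₂ f≤j | inj₁ j≤i
          rewrite when-yes (toℕ j <? suc (toℕ i)) (s≤s j≤i) {δ z j}
                | when-no (toℕ j <? toℕ f) (ℕ.≤⇒≯ f≤j) {δ z j}
                | when-yes ((toℕ f ≤? toℕ j) ×-dec (toℕ j ≤? toℕ i)) (f≤j , j≤i) {δ z j} = +-comm (δ z j) 0ℚ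
      ... | no i≁j | inj₂ f≤j | inj₂ i<j
          rewrite when-no (toℕ j <? suc (toℕ i)) (ℕ.<⇒≱ i<j ∘ ℕ.s≤s⁻¹) {δ z j}
                | when-no (toℕ j <? toℕ f) (ℕ.≤⇒≯ f≤j) {δ z j}
                | when-no ((toℕ f ≤? toℕ j) ×-dec (toℕ j ≤? toℕ i)) (ℕ.<⇒≱ i<j ∘ proj₂) {δ z j} = refl

    δ-nonNeg : ∀ j → pick (owner j) ≢ j → 0ℚ ≤ δ z j
    δ-nonNeg j p≢j = begin
      0ℚ                                     ≡⟨ *-zeroʳ (d (owner j)) ⟨
      d (owner j) * 0ℚ                       ≤⟨ *-monoˡ-≤-nonNeg (d (owner j)) {{nonNegative (d≥0 (owner j))}} (y≥0 j) ⟩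
      d (owner j) * y j                      ≡⟨ solve 2 (λ a b → a :* b := a :* b :- a :* con 0ℚ) refl (d (owner j)) (y j) ⟩
      d (owner j) * y j - d (owner j) * 0ℚ   ≡⟨ cong (λ q → d (owner j) * y j - d (owner j) * q) (trans (z≗ j) (when-no (pick (owner j) ≟ j) p≢j)) ⟨
      δ z j                                  ∎
      where open ≤-Reasoning

    excess-mono : ∀ i → pick (owner i) ≢ i → excess z (toℕ i) ≤ excess z (suc (toℕ i))
    excess-mono i p≢i = begin
      excess z (toℕ i)          ≡⟨ +-identityʳ _ ⟨
      excess z (toℕ i) + 0ℚ     ≤⟨ +-monoʳ-≤ (excess z (toℕ i)) (δ-nonNeg i p≢i) ⟩
      excess z (toℕ i) + δ z i  ≡⟨ excess-suc z i ⟨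
      excess z (suc (toℕ i))    ∎
      where open ≤-Reasoning

    Bounded : ℕ → Set
    Bounded n = 0ℚ ≤ excess z n × excess z n ≤ D

    -- The induction is strong because the excess after `i` is compared with the one before `f`,
    -- which may lie far to the left. Before the pick the upper bound is the recorded reason for
    -- skipping; from the pick on it is inherited from `f`, as `tail i` is nonnegative.
    bounded-suc : ∀ i → (∀ n → n ℕ.≤ toℕ i → Bounded n) → Bounded (suc (toℕ i))
    bounded-suc i ih = lower , upper
      where
      s = owner i

      first : ∃[ f ] owner f ≡ s × (∀ j → owner j ≡ s → toℕ f ℕ.≤ toℕ j)
      first = least (λ j → owner j ≡ s) (λ j → owner j ≟ s) i refl

      f   = proj₁ first
      eqn = excess+tail f i (proj₁ (proj₂ first)) (proj₂ (proj₂ first))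
      ihf = ih (toℕ f) (proj₂ (proj₂ first) i refl)

      upper : excess z (suc (toℕ i)) ≤ D
      upper with ℕ.<-≤-connex (toℕ i) (toℕ (pick s))
      ... | inj₁ i<p = before greedy i (toℕ<n i) i<p
      ... | inj₂ p≤i = begin
        excess z (suc (toℕ i))            ≡⟨ +-identityʳ _ ⟨
        excess z (suc (toℕ i)) + 0ℚ       ≤⟨ +-monoʳ-≤ (excess z (suc (toℕ i))) tail≥0 ⟩
        excess z (suc (toℕ i)) + tail i   ≡⟨ eqn ⟩
        excess z (toℕ f)                  ≤⟨ proj₂ ihf ⟩
        D                                 ∎
        where
        open ≤-Reasoning
        tail≥0 : 0ℚ ≤ tail i
        tail≥0 = sum-nonNeg λ j → when-nonNeg ((s ≟ owner j) ×-dec (toℕ i <? toℕ j))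
          λ (s≡ , i<j) → δ-nonNeg j λ p≡j →
            ℕ.<⇒≱ i<j (subst (ℕ._≤ toℕ i) (cong toℕ (trans (cong pick s≡) p≡j)) p≤i)

      lower : 0ℚ ≤ excess z (suc (toℕ i))
      -- Only a pick can make the excess drop; everywhere else `δ` is nonnegative.
      lower with pick s ≟ i
      ... | no p≢i = ≤-trans (proj₁ (ih (toℕ i) ℕ.≤-refl)) (excess-mono i p≢i)
      ... | yes p≡i with at greedy i (toℕ<n i) p≡i
      ...   | inj₁ 0≤e  = 0≤e
      ...   | inj₂ last = ≤-trans (proj₁ ihf) (≤-reflexive (trans (sym eqn)
                (trans (cong (excess z (suc (toℕ i)) +_) tail≡0) (+-identityʳ _))))
        where
        tail≡0 : tail i ≡ 0ℚ
        tail≡0 = sum-zero {f = λ j → when ((s ≟ owner j) ×-dec (toℕ i <? toℕ j)) (δ z j)}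
          λ j → when-no ((s ≟ owner j) ×-dec (toℕ i <? toℕ j))
            λ (s≡ , i<j) → ℕ.<⇒≱ i<j (last j (sym s≡))

    bounded-upTo : ∀ n → n ℕ.≤ ℓ → ∀ m → m ℕ.≤ n → Bounded m
    bounded-upTo zero _ .0 z≤n =
      subst (λ e → 0ℚ ≤ e × e ≤ D) (sym (excess-zero z)) (≤-refl , 0≤D)
    bounded-upTo (suc n) n<ℓ m m≤1+n with ℕ.m≤n⇒m<n∨m≡n m≤1+n
    ... | inj₁ m<1+n = bounded-upTo n (ℕ.<⇒≤ n<ℓ) m (ℕ.s≤s⁻¹ m<1+n)
    ... | inj₂ refl  = subst (Bounded ∘ suc) i≡n (bounded-suc (fromℕ< n<ℓ)
            λ l l≤i → bounded-upTo n (ℕ.<⇒≤ n<ℓ) l (subst (l ℕ.≤_) i≡n l≤i))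
      where
      i≡n = toℕ-fromℕ< n<ℓ

    bounded : ∀ n → n ℕ.≤ ℓ → Bounded n
    bounded n n≤ℓ = bounded-upTo n n≤ℓ n ℕ.≤-refl

∣p∣≤-intro : ∀ {p q} → p ≤ q → - p ≤ q → ∣ p ∣ ≤ q
∣p∣≤-intro {p} p≤q -p≤q with ∣p∣≡p∨∣p∣≡-p p
... | inj₁ eq = subst (_≤ _) (sym eq) p≤q
... | inj₂ eq = subst (_≤ _) (sym eq) -p≤q

-- Discrepancy of a greedy rounding

module _ (w : WPCS) (nonInterleaving : NonInterleaving (𝒮 w)) where

  private
    S = 𝒮 w
    n = ℓ w
    owner = memberOf S

  owner-unique : ∀ {i s} → i ∈ member S s → owner i ≡ s
  owner-unique {i} {s} i∈s with owner i ≟ s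
  ... | yes eq = eq
  ... | no  ≢s = ⊥-elim (disjoint S (owner i) s ≢s
                   (i , x∈p∩q⁺ (proj₂ (covering S i) , i∈s)))

  member-lookup : ∀ s i → lookup (member S s) i ≡ does (s ≟ owner i)
  member-lookup s i with s ≟ owner i
  ... | yes refl = []=⇒lookup (proj₂ (covering S i))
  ... | no  s≢ with lookup (member S s) i in eq
  ...   | true  = ⊥-elim (s≢ (sym (owner-unique (lookup⇒[]= i (member S s) eq))))
  ...   | false = refl

  member-total : ∀ q s → q ⟨ member S s ⟩ ≡ sum (λ i → when (s ≟ owner i) (q i))
  member-total q s = sum-cong-≗ λ i →
    cong (λ b → if b then q i else 0ℚ) (member-lookup s i)

  owner-noncrossing : ∀ a b c e → toℕ a ℕ.< toℕ b → toℕ b ℕ.< toℕ c → toℕ c ℕ.< toℕ e →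
                      owner a ≡ owner c → owner b ≡ owner e → owner a ≡ owner b
  owner-noncrossing a b c e a<b b<c c<e a~c b~e with owner a ≟ owner b
  ... | yes a~b = a~b
  ... | no  a≁b = ⊥-elim (nonInterleaving (owner a) (owner b) a≁b
    ( a , c , b , e
    , proj₂ (covering S a) , subst (λ s → c ∈ member S s) (sym a~c) (proj₂ (covering S c))
    , proj₂ (covering S b) , subst (λ s → e ∈ member S s) (sym b~e) (proj₂ (covering S e))
    , inj₁ (a<b , b<c , c<e)))

  d≤dmax : ∀ s → d w s ≤ dmax w
  d≤dmax s = All.lookup (xs≤max 0ℚ (tabulateᴸ (d w))) (∈-tabulate⁺ {f = d w} s)

  0≤dmax : 0ℚ ≤ dmax w
  0≤dmax = ⊥≤max 0ℚ (tabulateᴸ (d w))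

  module Rounding (D : ℚ) (0≤D : 0ℚ ≤ D) (d≤D : ∀ s → d w s ≤ D) where

    open Greedy owner (d w) (y w) D (WPCS.d-nonneg w) d≤D 0≤D
      (FractionalSelection.lower (WPCS.fractional w))
      (λ s → trans (sym (member-total (y w) s)) (FractionalSelection.unit (WPCS.fractional w) s))
      owner-noncrossing public

    open ℚ-Solver using (solve; _:+_; _:*_; _:-_; _:=_; :-_; con)

    module _ {pick : Fin (size S) → Fin n} {z : Vector ℚ n} (greedy : Greedy n pick z) where

      integral : IntegralSelection S z
      integral = record { binary = binary ; unit = λ s → trans (member-total z s) (z-unit greedy s) }
        where
        binary : ∀ i → z i ≡ 0ℚ ⊎ z i ≡ 1ℚ
        binary i with pick (owner i) ≟ i | z≗ greedy i
        ... | yes _ | eq = inj₂ eq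
        ... | no  _ | eq = inj₁ eq

      -- An arc that does not wrap telescopes. One that wraps omits the positions strictly between
      -- `j` and `i`, and as `δ` sums to 0 over all positions, this leads to the same difference.
      arc-sum : ∀ i j → δ z ⟨ arc i j ⟩ ≡ excess z (suc (toℕ j)) - excess z (toℕ i)
      arc-sum i j = begin
        δ z ⟨ arc i j ⟩
          ≡⟨ solve 2 (λ a e → a := a :+ e :- e) refl (δ z ⟨ arc i j ⟩) (excess z (toℕ i)) ⟩
        δ z ⟨ arc i j ⟩ + excess z (toℕ i) - excess z (toℕ i)
          ≡⟨ cong (_- excess z (toℕ i)) arc+excess ⟩
        excess z (suc (toℕ j)) - excess z (toℕ i) ∎
        where
        open ≡-Reasoning

        in-arc : Fin n → ℚ
        in-arc l = if lookup (arc i j) l then δ z l else 0ℚ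

        -- The body of `arc` with the outcome of its test as a parameter, so that the outcome known
        -- in each case can be substituted.
        wrap : Bool → Fin n → Bool
        wrap b l = if b then does (toℕ i ≤? toℕ l) ∧ does (toℕ l ≤? toℕ j)
                        else does (toℕ i ≤? toℕ l) ∨ does (toℕ l ≤? toℕ j)

        in-arc≡ : ∀ {b} → does (toℕ i ≤? toℕ j) ≡ b → ∀ l →
                  in-arc l ≡ (if wrap b l then δ z l else 0ℚ)
        in-arc≡ eq l = cong (λ b → if b then δ z l else 0ℚ)
          (trans (lookup∘tabulate _ l) (cong (λ b → wrap b l) eq))

        arc+excess : δ z ⟨ arc i j ⟩ + excess z (toℕ i) ≡ excess z (suc (toℕ j))
        arc+excess with toℕ i ≤? toℕ j
        ... | yes i≤j = trans (sum-+-cong split) (trans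
                (cong (excess z (suc (toℕ j)) +_) (sum-replicate-zero n)) (+-identityʳ _))
          where
          split : ∀ l → in-arc l + when (toℕ l <? toℕ i) (δ z l) ≡
                        when (toℕ l <? suc (toℕ j)) (δ z l) + 0ℚ
          split l rewrite in-arc≡ (dec-true (toℕ i ≤? toℕ j) i≤j) l
            with ℕ.<-≤-connex (toℕ l) (toℕ i) | ℕ.≤-<-connex (toℕ l) (toℕ j)
          ... | inj₁ l<i | inj₂ j<l = ⊥-elim (ℕ.<⇒≱ (ℕ.<-trans j<l l<i) i≤j)
          ... | inj₁ l<i | inj₁ l≤j
              rewrite when-no ((toℕ i ≤? toℕ l) ×-dec (toℕ l ≤? toℕ j)) (ℕ.<⇒≱ l<i ∘ proj₁) {δ z l}
                    | when-yes (toℕ l <? toℕ i) l<i {δ z l}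
                    | when-yes (toℕ l <? suc (toℕ j)) (s≤s l≤j) {δ z l} = +-comm 0ℚ (δ z l)
          ... | inj₂ i≤l | inj₁ l≤j
              rewrite when-yes ((toℕ i ≤? toℕ l) ×-dec (toℕ l ≤? toℕ j)) (i≤l , l≤j) {δ z l}
                    | when-no (toℕ l <? toℕ i) (ℕ.≤⇒≯ i≤l) {δ z l}
                    | when-yes (toℕ l <? suc (toℕ j)) (s≤s l≤j) {δ z l} = refl
          ... | inj₂ i≤l | inj₂ j<l
              rewrite when-no ((toℕ i ≤? toℕ l) ×-dec (toℕ l ≤? toℕ j)) (ℕ.<⇒≱ j<l ∘ proj₂) {δ z l}
                    | when-no (toℕ l <? toℕ i) (ℕ.≤⇒≯ i≤l) {δ z l}
                    | when-no (toℕ l <? suc (toℕ j)) (ℕ.<⇒≱ j<l ∘ ℕ.s≤s⁻¹) {δ z l} = refl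
        ... | no i≰j = trans (sum-+-cong split) (trans
                (cong (excess z (suc (toℕ j)) +_) total) (+-identityʳ _))
          where
          total : sum (δ z) ≡ 0ℚ
          -- The predicate holds everywhere, with the position itself as witness: the whole ground
          -- set is a union of members.
          total = saturated-sum greedy (λ l → yes l) (λ _ j _ _ → j)

          split : ∀ l → in-arc l + when (toℕ l <? toℕ i) (δ z l) ≡
                        when (toℕ l <? suc (toℕ j)) (δ z l) + δ z l
          split l rewrite in-arc≡ (dec-false (toℕ i ≤? toℕ j) i≰j) l
            with ℕ.<-≤-connex (toℕ l) (toℕ i) | ℕ.≤-<-connex (toℕ l) (toℕ j)
          ... | inj₂ i≤l | inj₁ l≤j = ⊥-elim (i≰j (ℕ.≤-trans i≤l l≤j))
          ... | inj₁ l<i | inj₁ l≤j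
              rewrite when-yes ((toℕ i ≤? toℕ l) ⊎-dec (toℕ l ≤? toℕ j)) (inj₂ l≤j) {δ z l}
                    | when-yes (toℕ l <? toℕ i) l<i {δ z l}
                    | when-yes (toℕ l <? suc (toℕ j)) (s≤s l≤j) {δ z l} = refl
          ... | inj₁ l<i | inj₂ j<l
              rewrite when-no ((toℕ i ≤? toℕ l) ⊎-dec (toℕ l ≤? toℕ j)) [ ℕ.<⇒≱ l<i , ℕ.<⇒≱ j<l ]′ {δ z l}
                    | when-yes (toℕ l <? toℕ i) l<i {δ z l}
                    | when-no (toℕ l <? suc (toℕ j)) (ℕ.<⇒≱ j<l ∘ ℕ.s≤s⁻¹) {δ z l} = refl
          ... | inj₂ i≤l | inj₂ j<l
              rewrite when-yes ((toℕ i ≤? toℕ l) ⊎-dec (toℕ l ≤? toℕ j)) (inj₁ i≤l) {δ z l}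
                    | when-no (toℕ l <? toℕ i) (ℕ.≤⇒≯ i≤l) {δ z l}
                    | when-no (toℕ l <? suc (toℕ j)) (ℕ.<⇒≱ j<l ∘ ℕ.s≤s⁻¹) {δ z l} = +-comm (δ z l) 0ℚ

      load-difference : ∀ I → load w (y w) ⟨ I ⟩ - load w z ⟨ I ⟩ ≡ δ z ⟨ I ⟩
      load-difference I = begin
        load w (y w) ⟨ I ⟩ - load w z ⟨ I ⟩
          ≡⟨ solve 2 (λ a b → a :- b := a :+ con 0ℚ :- b) refl (load w (y w) ⟨ I ⟩) (load w z ⟨ I ⟩) ⟩
        load w (y w) ⟨ I ⟩ + 0ℚ - load w z ⟨ I ⟩
          ≡⟨ cong (λ q → load w (y w) ⟨ I ⟩ + q - load w z ⟨ I ⟩) (sum-replicate-zero n) ⟨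
        load w (y w) ⟨ I ⟩ + sum {n} (const 0ℚ) - load w z ⟨ I ⟩
          ≡⟨ cong (_- load w z ⟨ I ⟩) (sum-+-cong split) ⟩
        load w z ⟨ I ⟩ + δ z ⟨ I ⟩ - load w z ⟨ I ⟩
          ≡⟨ solve 2 (λ a b → a :+ b :- a := b) refl (load w z ⟨ I ⟩) (δ z ⟨ I ⟩) ⟩
        δ z ⟨ I ⟩ ∎
        where
        open ≡-Reasoning
        split : ∀ i → (if lookup I i then load w (y w) i else 0ℚ) + 0ℚ ≡
                      (if lookup I i then load w z i else 0ℚ) + (if lookup I i then δ z i else 0ℚ)
        split i with lookup I i
        ... | true  = solve 2 (λ a b → a :+ con 0ℚ := b :+ (a :- b)) refl (load w (y w) i) (load w z i)
        ... | false = refl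

      ∅-discrepancy : discrepancyOn w z ⊥ ≡ 0ℚ
      ∅-discrepancy = cong ∣_∣ (trans (load-difference ⊥)
        (sum-zero λ i → cong (λ b → if b then δ z i else 0ℚ) (lookup-replicate i _)))

      difference≤D : ∀ a b → a ℕ.≤ n → b ℕ.≤ n → excess z a - excess z b ≤ D
      difference≤D a b a≤n b≤n = begin
        excess z a - excess z b  ≤⟨ +-mono-≤ (proj₂ (bounded greedy a a≤n)) (neg-antimono-≤ (proj₁ (bounded greedy b b≤n))) ⟩
        D + 0ℚ                   ≡⟨ +-identityʳ D ⟩
        D                        ∎
        where open ≤-Reasoning

      arc-discrepancy : ∀ i j → discrepancyOn w z (arc i j) ≤ D
      arc-discrepancy i j = subst (λ q → ∣ q ∣ ≤ D)
        (sym (trans (load-difference (arc i j)) (arc-sum i j)))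
        (∣p∣≤-intro (difference≤D (suc (toℕ j)) (toℕ i) (toℕ<n j) (ℕ.<⇒≤ (toℕ<n i)))
          (≤-trans (≤-reflexive (solve 2 (λ a b → :- (a :- b) := b :- a) refl
                      (excess z (suc (toℕ j))) (excess z (toℕ i))))
            (difference≤D (toℕ i) (suc (toℕ j)) (ℕ.<⇒≤ (toℕ<n i)) (toℕ<n j))))

      discrepancy≤D : discrepancy w z ≤ D
      discrepancy≤D = max≤v⁺ (≤-trans (≤-reflexive ∅-discrepancy) 0≤D)
        (All.map⁺ (All.cartesianProductWith⁺ (setoid _) (setoid _) arc (allFin n) (allFin n)
          λ {i} {j} _ _ → arc-discrepancy i j))

-- Programs

<ᵇ-true : ∀ {m n} → m ℕ.< n → (m ℕ.<ᵇ n) ≡ true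
<ᵇ-true {m} {n} = dec-true (m <? n)

<ᵇ-false : ∀ {m n} → n ℕ.≤ m → (m ℕ.<ᵇ n) ≡ false
<ᵇ-false {m} {n} n≤m = dec-false (m <? n) (ℕ.≤⇒≯ n≤m)

module _ {A : Set} (m : ℕ → ℕ → A) (a : ℕ) (v : A) where

  update-same : ∀ {k k′} → k ≡ k′ → update m a k v a k′ ≡ v
  update-same {k} refl
    rewrite dec-true (a ℕ.≟ a) refl | dec-true (k ℕ.≟ k) refl = refl

  update-other : ∀ {k k′} → k ≢ k′ → update m a k v a k′ ≡ m a k′
  update-other {k} {k′} k≢k′
    rewrite dec-true (a ℕ.≟ a) refl | dec-false (k ℕ.≟ k′) k≢k′ = refl

-- A total-correctness Hoare triple with a time bound, for a fixed initial state.
Runs : Program → State → ℕ → (State → Set) → Set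
Runs p σ c Q = ∃[ t ] ∃[ σ′ ] Exec p σ t σ′ × t ℕ.≤ c × Q σ′

runs-then : ∀ {p q σ b c Q R} → Runs p σ b Q → (∀ {σ′} → Q σ′ → Runs q σ′ c R) →
            Runs (p then q) σ (b ℕ.+ c) R
runs-then (_ , _ , ep , t≤b , Qσ) cont with cont Qσ
... | _ , _ , eq , u≤c , Rσ = _ , _ , seq ep eq , ℕ.+-mono-≤ t≤b u≤c , Rσ

counter : NatExp
counter = read 3 (lit 0)

forAll : Program → Program
forAll body = while (ltN counter (read 0 (lit 0))) body

runs-map : ∀ {p σ c Q R} → (∀ {σ′} → Q σ′ → R σ′) → Runs p σ c Q → Runs p σ c R
runs-map f (t , σ′ , exec , t≤c , Qσ) = t , σ′ , exec , t≤c , f Qσ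

runs-weaken : ∀ {p σ b c Q} → b ℕ.≤ c → Runs p σ b Q → Runs p σ c Q
runs-weaken b≤c (t , σ′ , exec , t≤b , Qσ) = t , σ′ , exec , ℕ.≤-trans t≤b b≤c , Qσ

module _ {body : Program} {n c : ℕ} (Inv : ℕ → State → Set)
  (guard : ∀ {i σ} → Inv i σ → nat σ 3 0 ≡ i × nat σ 0 0 ≡ n)
  (step : ∀ (i : Fin n) {σ} → Inv (toℕ i) σ → Runs body σ c (Inv (suc (toℕ i)))) where

  private
    guard-value : ∀ {i σ b} → (i ℕ.<ᵇ n) ≡ b → Inv i σ →
                  evalB σ (ltN counter (read 0 (lit 0))) ≡ b
    guard-value eq inv with guard inv
    ... | refl , refl = eq

    -- Induction on the number `r` of remaining rounds. The constant 6 is the price of evaluating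
    -- the guard together with the control step, paid once more by the final failing test.
    forAll-from : ∀ r {i σ} → i ℕ.+ r ≡ n → Inv i σ →
                  Runs (forAll body) σ (6 ℕ.+ r ℕ.* (6 ℕ.+ c)) (Inv n)
    forAll-from zero {i} i+0≡n inv rewrite trans (sym (ℕ.+-identityʳ i)) i+0≡n =
      _ , _ , while-false (guard-value (<ᵇ-false {n} ℕ.≤-refl) inv) , ℕ.≤-refl , inv
    forAll-from (suc r) {i} {σ} i+r≡n inv
      with step (fromℕ< i<n) (subst (λ l → Inv l σ) (sym (toℕ-fromℕ< i<n)) inv)
      where
      i<n : i ℕ.< n
      i<n = subst (i ℕ.<_) i+r≡n (ℕ.m<m+n i (s≤s z≤n))
    ... | t , σ′ , exec , t≤c , inv′
      with forAll-from r {suc i} {σ′} (trans (sym (ℕ.+-suc i r)) i+r≡n)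
             (subst (λ l → Inv (suc l) σ′) (toℕ-fromℕ< _) inv′)
    ... | u , σ″ , exec′ , u≤ , inv″ =
      _ , σ″ , while-true (guard-value (<ᵇ-true (subst (i ℕ.<_) i+r≡n (ℕ.m<m+n i (s≤s z≤n)))) inv) exec exec′
      , bound , inv″
      where
      open ℕ.≤-Reasoning
      bound : 6 ℕ.+ t ℕ.+ u ℕ.≤ 6 ℕ.+ suc r ℕ.* (6 ℕ.+ c)
      bound = begin
        6 ℕ.+ t ℕ.+ u                                ≤⟨ ℕ.+-mono-≤ (ℕ.+-monoʳ-≤ 6 t≤c) u≤ ⟩
        6 ℕ.+ c ℕ.+ (6 ℕ.+ r ℕ.* (6 ℕ.+ c))          ≡⟨ solve 2 (λ c r → con 6 :+ c :+ (con 6 :+ r :* (con 6 :+ c))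
                                                         := con 6 :+ (con 6 :+ c :+ r :* (con 6 :+ c))) refl c r ⟩
        6 ℕ.+ suc r ℕ.* (6 ℕ.+ c)                    ∎
        where open ℕ-Solver

  forAll-runs : ∀ {σ} → Inv 0 σ → Runs (forAll body) σ (6 ℕ.+ n ℕ.* (6 ℕ.+ c)) (Inv n)
  forAll-runs = forAll-from n refl

-- Here `a` is the price of one round of a loop with its guard, 9 that of `reset`, 3 that of
-- rewinding the counter, and each 6 that of a failing guard; these constants add up to 24. With
-- `a = 70` the factor is 164.
linear-bound : ∀ n a → 9 ℕ.+ (6 ℕ.+ n ℕ.* a ℕ.+ (3 ℕ.+ (6 ℕ.+ n ℕ.* a))) ℕ.≤
                       (24 ℕ.+ (a ℕ.+ a)) ℕ.* suc n
linear-bound n a = begin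
  t                                     ≤⟨ ℕ.m≤m+n t (a ℕ.+ a ℕ.+ 24 ℕ.* n) ⟩
  t ℕ.+ (a ℕ.+ a ℕ.+ 24 ℕ.* n)          ≡⟨ solve 2 (λ n a →
    con 9 :+ (con 6 :+ n :* a :+ (con 3 :+ (con 6 :+ n :* a))) :+ (a :+ a :+ con 24 :* n) :=
    (con 24 :+ (a :+ a)) :* (con 1 :+ n)) refl n a ⟩
  (24 ℕ.+ (a ℕ.+ a)) ℕ.* suc n          ∎
  where
  open ℕ.≤-Reasoning
  open ℕ-Solver
  t = 9 ℕ.+ (6 ℕ.+ n ℕ.* a ℕ.+ (3 ℕ.+ (6 ℕ.+ n ℕ.* a)))

-- Work space: array 2 of naturals holds the position picked for each member,
-- cell 0 of array 3 the loop counter.  The first loop picks the last position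
-- of each member and computes the largest demand.
own pickOf : NatExp
own    = read 1 counter
pickOf = read 2 own

-- `limit` is the cell of the largest demand found so far, `current` that of the running excess.
demandOf limit current : RatExp
demandOf = read 0 own
limit    = read 3 (lit 0)
current  = read 3 (lit 1)

-- The condition `Selects`, with `≤` on naturals as a negated `<` and the disjunction by De Morgan.
selects : BoolExp
selects = and (neg (ltN pickOf counter)) (neg (and (ltN counter pickOf) (leQ current limit)))

advance reset scanBody roundBody solver : Program
advance = setNat 3 (lit 0) (add counter (lit 1))
reset   = setNat 3 (lit 0) (lit 0) then setRat 3 (lit 0) (lit 0ℚ) then setRat 3 (lit 1) (lit 0ℚ)

scanBody =
  setNat 2 own counter then
  branch (leQ demandOf limit) skip (setRat 3 (lit 0) demandOf) then
  advance

roundBody =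
  setRat 3 (lit 1) (add current (mul demandOf (read 1 counter))) then
  branch selects
    (setNat 2 own counter then
     setRat 2 counter (lit 1ℚ) then
     setRat 3 (lit 1) (sub current demandOf))
    (setRat 2 counter (lit 0ℚ)) then
  advance

solver =
  reset then forAll scanBody then setNat 3 (lit 0) (lit 0) then forAll roundBody

-- The equations carry the outcome from memory contents, on which the machine test is evaluated, to
-- the quantities that they represent.
select-test : ∀ {p p′ i i′ e e′ D D′} → p ≡ p′ → i ≡ i′ → e ≡ e′ → D ≡ D′ →
  let b = not (p ℕ.<ᵇ i) ∧ not ((i ℕ.<ᵇ p) ∧ (e ≤ᵇ D)) in
  (b ≡ true × Selects p′ i′ e′ D′) ⊎ (b ≡ false × Skips p′ i′ e′ D′)
select-test {p} {i = i} {e = e} {D = D} refl refl refl refl with ℕ.<-≤-connex p i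
... | inj₁ p<i rewrite <ᵇ-true p<i = inj₂ (refl , inj₁ p<i)
... | inj₂ i≤p rewrite <ᵇ-false i≤p with ℕ.<-≤-connex i p
...   | inj₂ p≤i rewrite <ᵇ-false p≤i = inj₁ (refl , i≤p , inj₁ p≤i)
...   | inj₁ i<p rewrite <ᵇ-true i<p with e ≤ᵇ D in eq
...     | true  = inj₂ (refl , inj₂ (i<p , ≤ᵇ⇒≤ (subst T (sym eq) tt)))
...     | false = inj₁ (refl , i≤p , inj₂ λ e≤D → subst T eq (≤⇒≤ᵇ e≤D))

-- Correctness of the scanning and the rounding loop

module _ (w : WPCS) (nonInterleaving : NonInterleaving (𝒮 w)) where

  private
    n = ℓ w
    owner = memberOf (𝒮 w)

  part-cell : ∀ {σ} → Encodes σ w → ∀ {c} (i : Fin n) → c ≡ toℕ i → nat σ 1 c ≡ toℕ (owner i)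
  part-cell enc i refl = Encodes.part enc i (owner i) (proj₂ (covering (𝒮 w) i))

  -- Members are met only through their positions, so `latest` and `demand≤` speak of owners; since
  -- members are nonempty, a complete scan covers all of them. `≤max` turns a bound by the computed
  -- limit into one by `dmax`.
  record Scanned (m : ℕ) (σ : State) : Set where
    field
      encodes : Encodes σ w
      count   : nat σ 3 0 ≡ m
      latest  : ∀ j → toℕ j ℕ.< m → ∃[ l ] owner l ≡ owner j × nat σ 2 (toℕ (owner j)) ≡ toℕ l ×
                  (∀ i → toℕ i ℕ.< m → owner i ≡ owner j → toℕ i ℕ.≤ toℕ l)
      nonNeg  : 0ℚ ≤ rat σ 3 0
      demand≤ : ∀ j → toℕ j ℕ.< m → d w (owner j) ≤ rat σ 3 0
      ≤max    : rat σ 3 0 ≤ dmax w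
      empty   : rat σ 3 1 ≡ 0ℚ

  scan-start : ∀ {σ} → Encodes σ w → Runs reset σ 9 (Scanned 0)
  scan-start enc = _ , _ , seq setNat (seq setRat setRat) , ℕ.≤-refl , record
    -- The program writes to arrays 2 and 3 only, so reads of the input arrays reduce to the old
    -- ones and the old proofs can be repackaged. The later invariants do the same.
    { encodes = record { Encodes enc }
    ; count   = refl
    ; latest  = λ _ ()
    ; nonNeg  = ≤-refl
    ; demand≤ = λ _ ()
    ; ≤max    = 0≤dmax w nonInterleaving
    ; empty   = refl
    }

  -- The number 64 is a round bound for either loop body. Exact costs are numerals, so the
  -- comparison is settled by evaluation.
  scan-step : ∀ i {σ} → Scanned (toℕ i) σ → Runs scanBody σ 64 (Scanned (suc (toℕ i)))
  scan-step i {σ} inv = step (rat σ 0 (nat σ 1 (nat σ 3 0)) ≤ᵇ rat σ 3 0) refl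
    where
    open Scanned inv

    s = owner i

    key : nat σ 1 (nat σ 3 0) ≡ toℕ s
    key = part-cell encodes i count

    cell : rat σ 0 (nat σ 1 (nat σ 3 0)) ≡ d w s
    cell = trans (cong (rat σ 0) key) (Encodes.demand encodes s)

    nat′ : ℕ → ℕ → ℕ
    nat′ = update (nat σ) 2 (nat σ 1 (nat σ 3 0)) (nat σ 3 0)

    earlier : ∀ {j} → toℕ j ℕ.< suc (toℕ i) → owner j ≢ s → toℕ j ℕ.< toℕ i
    earlier {j} j<1+i j∉s = ℕ.≤∧≢⇒< (ℕ.s≤s⁻¹ j<1+i) λ j≡i → j∉s (cong owner (toℕ-injective j≡i))

    latest′ : ∀ j → toℕ j ℕ.< suc (toℕ i) → ∃[ l ] owner l ≡ owner j × nat′ 2 (toℕ (owner j)) ≡ toℕ l ×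
              (∀ h → toℕ h ℕ.< suc (toℕ i) → owner h ≡ owner j → toℕ h ℕ.≤ toℕ l)
    latest′ j j<1+i with owner j ≟ s
    ... | yes j∈s = i , sym j∈s
          , trans (update-same (nat σ) 2 (nat σ 3 0) (trans key (cong toℕ (sym j∈s)))) count
          , λ h h<1+i _ → ℕ.s≤s⁻¹ h<1+i
    ... | no  j∉s with latest j (earlier j<1+i j∉s)
    ...   | l , l~j , stored , last = l , l~j
          , trans (update-other (nat σ) 2 (nat σ 3 0)
              λ eq → j∉s (toℕ-injective (trans (sym eq) key))) stored
          , λ h h<1+i h~j → last h (earlier h<1+i λ h∈s → j∉s (trans (sym h~j) h∈s)) h~j

    demand≤′ : ∀ {D} → rat σ 3 0 ≤ D → d w s ≤ D → ∀ j → toℕ j ℕ.< suc (toℕ i) → d w (owner j) ≤ D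
    demand≤′ old new j j<1+i with owner j ≟ s
    ... | yes j∈s = subst (λ t → d w t ≤ _) (sym j∈s) new
    ... | no  j∉s = ≤-trans (demand≤ j (earlier j<1+i j∉s)) old

    count′ : nat σ 3 0 ℕ.+ 1 ≡ suc (toℕ i)
    count′ = trans (ℕ.+-comm (nat σ 3 0) 1) (cong suc count)

    step : ∀ b → (rat σ 0 (nat σ 1 (nat σ 3 0)) ≤ᵇ rat σ 3 0) ≡ b →
           Runs scanBody σ 64 (Scanned (suc (toℕ i)))
    step true eq = _ , _ , seq setNat (seq (if-true eq skip) setNat) , ℕ.≤ᵇ⇒≤ _ _ _ , record
      { encodes = record { Encodes encodes }
      ; count   = count′
      ; latest  = latest′
      ; nonNeg  = nonNeg
      ; demand≤ = demand≤′ ≤-refl (subst (_≤ rat σ 3 0) cell (≤ᵇ⇒≤ (subst T (sym eq) tt)))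
      ; ≤max    = ≤max
      ; empty   = empty
      }
    step false eq = _ , _ , seq setNat (seq (if-false eq setRat) setNat) , ℕ.≤ᵇ⇒≤ _ _ _ , record
      { encodes = record { Encodes encodes }
      ; count   = count′
      ; latest  = latest′
      ; nonNeg  = ≤-trans nonNeg limit≤
      ; demand≤ = demand≤′ limit≤ (≤-reflexive (sym cell))
      ; ≤max    = subst (_≤ dmax w) (sym cell) (d≤dmax w nonInterleaving s)
      ; empty   = empty
      }
      where
      limit≤ : rat σ 3 0 ≤ rat σ 0 (nat σ 1 (nat σ 3 0))
      limit≤ = <⇒≤ (≰⇒> λ le → subst T eq (≤⇒≤ᵇ le))

  module _ (D : ℚ) (0≤D : 0ℚ ≤ D) (d≤D : ∀ s → d w s ≤ D) where

    open Rounding w nonInterleaving D 0≤D d≤D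

    record Rounded (m : ℕ) (σ : State) : Set where
      field
        encodes : Encodes σ w
        count   : nat σ 3 0 ≡ m
        bound   : rat σ 3 0 ≡ D
        running : rat σ 3 1 ≡ excess (output σ n) m
        pick    : Fin (size (𝒮 w)) → Fin n
        stored  : ∀ s → nat σ 2 (toℕ s) ≡ toℕ (pick s)
        greedy  : Greedy m pick (output σ n)

    round-step : ∀ i {σ} → Rounded (toℕ i) σ → Runs roundBody σ 64 (Rounded (suc (toℕ i)))
    round-step i {σ} inv = step (select-test pick≡ count excess≡ bound)
      where
      open Rounded inv

      s = owner i
      z = output σ n
      σ₁ = ⟪ nat σ , update (rat σ) 3 1 (evalQ σ (add current (mul demandOf (read 1 counter)))) ⟫

      key : nat σ 1 (nat σ 3 0) ≡ toℕ s
      key = part-cell encodes i count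

      cell : rat σ 0 (nat σ 1 (nat σ 3 0)) ≡ d w s
      cell = trans (cong (rat σ 0) key) (Encodes.demand encodes s)

      pick≡ : nat σ 2 (nat σ 1 (nat σ 3 0)) ≡ toℕ (pick s)
      pick≡ = trans (cong (nat σ 2) key) (stored s)

      excess≡ : rat σ 3 1 + rat σ 0 (nat σ 1 (nat σ 3 0)) * rat σ 1 (nat σ 3 0) ≡
                excess z (toℕ i) + d w s * y w i
      excess≡ = cong₂ _+_ running (cong₂ _*_ cell
        (trans (cong (rat σ 1) count) (Encodes.select encodes i)))

      count′ : nat σ 3 0 ℕ.+ 1 ≡ suc (toℕ i)
      count′ = trans (ℕ.+-comm (nat σ 3 0) 1) (cong suc count)

      z′ : ℚ → Vector ℚ n
      z′ v j = update (rat σ) 2 (nat σ 3 0) v 2 (toℕ j)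

      z′-here : ∀ v → z′ v i ≡ v
      z′-here v = update-same (rat σ) 2 v count

      z′-other : ∀ v j → j ≢ i → z′ v j ≡ z j
      z′-other v j j≢i = update-other (rat σ) 2 v
        λ c≡j → j≢i (toℕ-injective (trans (sym c≡j) count))

      pick′ : Fin (size (𝒮 w)) → Fin n
      pick′ = updateAt pick s (const i)

      stored′ : ∀ t → update (nat σ) 2 (nat σ 1 (nat σ 3 0)) (nat σ 3 0) 2 (toℕ t) ≡ toℕ (pick′ t)
      stored′ t with t ≟ s
      ... | yes refl = trans (update-same (nat σ) 2 (nat σ 3 0) key)
                             (trans count (cong toℕ (sym (updateAt-updates s pick))))
      ... | no  t≢s  = trans (update-other (nat σ) 2 (nat σ 3 0)
                                λ eq → t≢s (toℕ-injective (trans (sym eq) key)))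
                             (trans (stored t) (cong toℕ (sym (updateAt-minimal t s pick t≢s))))

      step :
        (evalB σ₁ selects ≡ true × Selects (toℕ (pick s)) (toℕ i) (excess z (toℕ i) + d w s * y w i) D) ⊎
        (evalB σ₁ selects ≡ false × Skips (toℕ (pick s)) (toℕ i) (excess z (toℕ i) + d w s * y w i) D) →
        Runs roundBody σ 64 (Rounded (suc (toℕ i)))
      step (inj₁ (test , select)) =
        _ , _ , seq setRat (seq (if-true test (seq setNat (seq setRat setRat))) setNat) ,
        ℕ.≤ᵇ⇒≤ _ _ _ , record
        { encodes = record { Encodes encodes }
        ; count   = count′
        ; bound   = bound
        ; running = trans (cong₂ _-_ excess≡ cell)
                          (sym (excess-select i (z′-other 1ℚ) greedy (z′-here 1ℚ)))
        ; pick    = pick′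
        ; stored  = stored′
        ; greedy  = greedy-select i (z′-other 1ℚ) greedy (z′-here 1ℚ) select
        }
      step (inj₂ (test , skipped)) =
        _ , _ , seq setRat (seq (if-false test setRat) setNat) , ℕ.≤ᵇ⇒≤ _ _ _ , record
        { encodes = record { Encodes encodes }
        ; count   = count′
        ; bound   = bound
        ; running = trans excess≡ (sym (excess-skip i (z′-other 0ℚ) greedy (z′-here 0ℚ)))
        ; pick    = pick
        ; stored  = stored
        ; greedy  = greedy-skip i (z′-other 0ℚ) greedy (z′-here 0ℚ) skipped
        }

  Solved : State → Set
  Solved σ = IntegralSelection (𝒮 w) (output σ n) × discrepancy w (output σ n) ≤ dmax w

  round-runs : ∀ {σ} → Scanned n σ →
    Runs (setNat 3 (lit 0) (lit 0) then forAll roundBody) σ (3 ℕ.+ (6 ℕ.+ n ℕ.* 70)) Solved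
  round-runs {σ} scanned = runs-map solved
    (runs-then start (forAll-runs (Rounded D nonNeg d≤D)
      (λ inv → Rounded.count inv , Encodes.ground (Rounded.encodes inv))
      (round-step D nonNeg d≤D)))
    where
    open Scanned scanned
    D = rat σ 3 0

    element : ∀ s → ∃[ i ] owner i ≡ s
    element s with nonempty (𝒮 w) s
    ... | i , i∈s = i , owner-unique w nonInterleaving i∈s

    d≤D : ∀ s → d w s ≤ D
    d≤D s with element s
    ... | i , refl = demand≤ i (toℕ<n i)

    open Rounding w nonInterleaving D nonNeg d≤D

    last : ∀ s → ∃[ l ] owner l ≡ s × nat σ 2 (toℕ s) ≡ toℕ l ×
             (∀ i → owner i ≡ s → toℕ i ℕ.≤ toℕ l)
    last s with element s
    ... | i , refl with latest i (toℕ<n i)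
    ...   | l , l~i , stored , max = l , l~i , stored , λ j → max j (toℕ<n j)

    start : Runs (setNat 3 (lit 0) (lit 0)) σ 3 (Rounded D nonNeg d≤D 0)
    start = _ , _ , setNat , ℕ.≤-refl , record
      { encodes = record { Encodes encodes }
      ; count   = refl
      ; bound   = refl
      ; running = trans empty (sym (excess-zero (output σ n)))
      ; pick    = proj₁ ∘ last
      ; stored  = proj₁ ∘ proj₂ ∘ proj₂ ∘ last
      ; greedy  = greedy-start (proj₁ ∘ last) (output σ n) (proj₁ ∘ proj₂ ∘ last)
                    (λ j → proj₂ (proj₂ (proj₂ (last (owner j)))) j refl)
      }

    solved : ∀ {σ′} → Rounded D nonNeg d≤D n σ′ → Solved σ′
    solved inv = integral (Rounded.greedy inv) , ≤-trans (discrepancy≤D (Rounded.greedy inv)) ≤max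

  solver-runs : ∀ {σ} → Encodes σ w → Runs solver σ (164 ℕ.* suc n) Solved
  solver-runs enc = runs-weaken (linear-bound n 70)
    (runs-then (scan-start enc) (λ start → runs-then
      (forAll-runs Scanned (λ inv → Scanned.count inv , Encodes.ground (Scanned.encodes inv))
        scan-step start)
      round-runs))

-- Instances as memory contents, and the theorem

extend : ∀ {A : Set} {n} → Vector A n → A → ℕ → A
extend {n = zero}  v x _       = x
extend {n = suc n} v x zero    = v zero
extend {n = suc n} v x (suc k) = extend (v ∘ suc) x k

extend-toℕ : ∀ {A : Set} {n} (v : Vector A n) x i → extend v x (toℕ i) ≡ v i
extend-toℕ v x zero    = refl
extend-toℕ v x (suc i) = extend-toℕ (v ∘ suc) x i

encode : WPCS → State
encode w = ⟪ nats , rats ⟫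
  where
  nats : ℕ → ℕ → ℕ
  nats zero zero    = ℓ w
  nats zero (suc _) = size (𝒮 w)
  nats (suc _)      = extend (toℕ ∘ memberOf (𝒮 w)) 0
  rats : ℕ → ℕ → ℚ
  rats zero    = extend (d w) 0ℚ
  rats (suc _) = extend (y w) 0ℚ

encode-encodes : ∀ w → NonInterleaving (𝒮 w) → Encodes (encode w) w
encode-encodes w ni = record
  { ground  = refl
  ; members = refl
  ; part    = λ i s i∈s → trans (extend-toℕ (toℕ ∘ memberOf (𝒮 w)) 0 i)
                                (cong toℕ (owner-unique w ni i∈s))
  ; demand  = extend-toℕ (d w) 0ℚ
  ; select  = extend-toℕ (y w) 0ℚ
  }

mainTheorem8 : (∀ (w : WPCS) → NonInterleaving (𝒮 w) →
    ∃[ z ] IntegralSelection (𝒮 w) z × discrepancy w z ≤ dmax w)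
    ×
    ComputableInLinearTime
    (λ w → NonInterleaving (𝒮 w))
    (λ w z → IntegralSelection (𝒮 w) z × discrepancy w z ≤ dmax w)
mainTheorem8 = existence , solver , 164 , λ w ni σ → solver-runs w ni
  where
  existence : ∀ w → NonInterleaving (𝒮 w) →
              ∃[ z ] IntegralSelection (𝒮 w) z × discrepancy w z ≤ dmax w
  existence w ni =
    let _ , σ′ , _ , _ , solved = solver-runs w ni (encode-encodes w ni)
    in output σ′ (ℓ w) , solved
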